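{- There exist a planar graph $G$ of girth $4$ and a signature $\sigma: E(G)\to\{1,-1\}$ such that the signed graph $(G,\sigma)$ is not $3$-choosable, but the unsigned graph $G$ is $3$-choosable.
   Context: All graphs are finite and simple. The girth of a graph is the length of a shortest cycle. A signed graph is a pair $(G,\sigma)$ where $G$ is a graph and $\sigma: E(G)\to\{1,-1\}$ is a mapping, called a signature of $G$. A proper coloring of $(G,\sigma)$ is a map $c: V(G)\to\mathbb{Z}$ such that $c(u)\neq \sigma(uv)\,c(v)$ for every edge $uv\in E(G)$. A list-assignment is a function $L$ on $V(G)$ with $\emptyset\neq L(v)\subseteq\mathbb{Z}$ for each $v\in V(G)$; it is a $k$-list-assignment if $|L(v)|=k$ for every $v\in V(G)$. An $L$-coloring is a proper coloring $c$ of $(G,\sigma)$ with $c(v)\in L(v)$ for every $v\in V(G)$. $(G,\sigma)$ is $k$-choosable if it has an $L$-coloring for every $k$-list-assignment $L$. The unsigned graph $G$ is $k$-choosable in the usual sense, i.e. for every $k$-list-assignment $L$ there is a map $c$ with $c(v)\in L(v)$ for all $v$ and $c(u)\ne c(v)$ for every edge $uv$ (equivalently, the signed graph with all edges of sign $1$ is $k$-choosable). -}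

module Defs where

open import Data.Bool using (Bool; T)
open import Data.Empty using (⊥)
open import Data.Fin as Fin using (Fin; toℕ)
open import Data.Integer as ℤ using (ℤ; _◃_)
open import Data.List using (List; []; _∷_; _++_; [_]; length)
open import Data.List.Membership.Propositional using (_∈_)
open import Data.List.Relation.Unary.Unique.Propositional using (Unique)
open import Data.Nat as ℕ using (ℕ; suc)
open import Data.Product using (Σ-syntax; _×_; _,_)
open import Data.Rational as ℚ using (ℚ; 0ℚ; 1ℚ)
open import Data.Sign using (Sign)
open import Data.Sum using (_⊎_)
open import Function.Definitions using (Injective)
open import Relation.Binary.PropositionalEquality using (_≡_; _≢_)
open import Relation.Nullary using (¬_)

record Graph : Set where
  field
    order  : ℕ
    adj    : Fin order → Fin order → Bool
    sym    : ∀ {u v} → T (adj u v) → T (adj v u)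
    irrefl : ∀ {v} → ¬ T (adj v v)

  Vertex : Set
  Vertex = Fin order

  Adj : Vertex → Vertex → Set
  Adj u v = T (adj u v)

open Graph using (Vertex; Adj)

-- An unordered pair {u , v} of adjacent vertices is represented by its
-- increasing enumeration, so that each edge occurs exactly once.
record Edge (G : Graph) : Set where
  constructor edge
  field
    src tgt : Vertex G
    src<tgt : src Fin.< tgt
    joined  : Adj G src tgt

open Edge using (src; tgt)

record Cycle (G : Graph) (k : ℕ) : Set where
  field
    3≤k      : 3 ℕ.≤ k
    vertex   : Fin k → Vertex G
    distinct : Injective _≡_ _≡_ vertex
    step     : ∀ i j → toℕ j ≡ suc (toℕ i) → Adj G (vertex i) (vertex j)
    close    : ∀ i j → suc (toℕ i) ≡ k → toℕ j ≡ 0 → Adj G (vertex i) (vertex j)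

HasGirth : Graph → ℕ → Set
HasGirth G g = Cycle G g × (∀ k → Cycle G k → g ℕ.≤ k)

-- Planarity: the graph can be drawn in the plane, with edges drawn as
-- polygonal arcs, so that the interior of an edge meets no vertex and no other
-- edge.  Rational coordinates lose nothing: whenever two segments with rational
-- endpoints meet in ℝ², they also meet in a point of ℚ², and if they meet in
-- more than one point of ℝ², they do so in ℚ².

Point : Set
Point = ℚ × ℚ

OnSegment : Point → Point → Point → Set
OnSegment (a₁ , a₂) (b₁ , b₂) (x₁ , x₂) =
  Σ[ t ∈ ℚ ] 0ℚ ℚ.≤ t × t ℚ.≤ 1ℚ
    × x₁ ≡ (1ℚ ℚ.- t) ℚ.* a₁ ℚ.+ t ℚ.* b₁
    × x₂ ≡ (1ℚ ℚ.- t) ℚ.* a₂ ℚ.+ t ℚ.* b₂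

OnPolyline : List Point → Point → Set
OnPolyline (p ∷ q ∷ ps) x = OnSegment p q x ⊎ OnPolyline (q ∷ ps) x
OnPolyline _            x = ⊥

-- The polyline is non-degenerate and does not meet itself.
IsArc : List Point → Set
IsArc []               = ⊥
IsArc (p ∷ [])         = ⊥
IsArc (p ∷ q ∷ [])     = p ≢ q
IsArc (p ∷ q ∷ r ∷ ps) =
    p ≢ q
  × (∀ x → OnSegment p q x → OnPolyline (q ∷ r ∷ ps) x → x ≡ q)
  × IsArc (q ∷ r ∷ ps)

record PlaneDrawing (G : Graph) : Set where
  field
    pos   : Vertex G → Point
    bends : Edge G → List Point

  arc : Edge G → List Point
  arc e = pos (src e) ∷ bends e ++ [ pos (tgt e) ]

  Interior : Edge G → Point → Set
  Interior e x = OnPolyline (arc e) x × x ≢ pos (src e) × x ≢ pos (tgt e)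

  field
    pos-injective : Injective _≡_ _≡_ pos
    arc-simple    : ∀ e → IsArc (arc e)
    avoids-vertex : ∀ e x → Interior e x → ∀ v → x ≢ pos v
    avoids-edge   : ∀ e x → Interior e x → ∀ f → f ≢ e → ¬ OnPolyline (arc f) x

Planar : Graph → Set
Planar = PlaneDrawing

Signature : Graph → Set
Signature G = Edge G → Sign

-- s ◃ 1 is the integer ±1.  Since (±1)² = 1, the condition does not depend on
-- which end of the edge is taken first.
IsProperSigned : (G : Graph) → Signature G → (Vertex G → ℤ) → Set
IsProperSigned G σ c = ∀ (e : Edge G) → c (src e) ≢ (σ e ◃ 1) ℤ.* c (tgt e)

IsProper : (G : Graph) → (Vertex G → ℤ) → Set
IsProper G c = ∀ (e : Edge G) → c (src e) ≢ c (tgt e)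

-- Finite sets of colours are duplicate-free lists.
record ListAssignment (G : Graph) (k : ℕ) : Set where
  field
    colours  : Vertex G → List ℤ
    unique   : ∀ v → Unique (colours v)
    nonempty : ∀ v → colours v ≢ []
    size     : ∀ v → length (colours v) ≡ k

open ListAssignment using (colours)

SignedChoosable : (G : Graph) → Signature G → ℕ → Set
SignedChoosable G σ k = ∀ (L : ListAssignment G k) →
  Σ[ c ∈ (Vertex G → ℤ) ] IsProperSigned G σ c × (∀ v → c v ∈ colours L v)

Choosable : Graph → ℕ → Set
Choosable G k = ∀ (L : ListAssignment G k) →
  Σ[ c ∈ (Vertex G → ℤ) ] IsProper G c × (∀ v → c v ∈ colours L v)

{-# OPTIONS --safe #-}
module Submission where

-- Two poles are joined to ten posts, which leaves nine consecutive quadrilateral cells pole–post–pole–post.  Each cell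
-- contains a 4-cycle whose vertices are joined to its four corners, one each.
--
-- Once the corners are coloured, every vertex of the inner 4-cycle keeps two colours.  A 4-cycle is 2-choosable, so the
-- unsigned graph is 3-choosable: colour poles, posts and cells in this order.  If one edge of the inner 4-cycle is negative,
-- the cycle cannot be coloured from {7, -7}, so suitable lists make the cell exclude one colouring of its corners.  With
-- disjoint lists at the poles there are nine colourings of the poles.  Each forces the posts of one cell when their lists
-- contain both pole colours, and that cell excludes the result.

open import Data.Bool using (Bool; true; false; T; _∧_; _∨_)
open import Data.Bool.Properties using (T-∧; T-∨; T-irrelevant; T?; ∨-comm; ¬-not)
open import Data.Empty using (⊥)
open import Data.Fin as Fin using (Fin; suc; inject₁; toℕ)
open import Data.Fin.Patterns
import Data.Fin.Properties as Fin
open import Data.Integer as ℤ using (ℤ; +_; -_; _◃_)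
import Data.Integer.Properties as ℤ
open import Data.List using (List; []; _∷_; length; filter; cartesianProduct; allFin)
open import Data.List.Membership.DecPropositional ℤ._≟_ using (_∈?_)
open import Data.List.Membership.Propositional using (_∈_)
open import Data.List.Membership.Propositional.Properties using (∈-filter⁺; ∈-cartesianProduct⁺; ∈-allFin)
open import Data.List.Relation.Unary.All as All using (All; []; _∷_)
open import Data.List.Relation.Unary.AllPairs using (_∷_)
open import Data.List.Relation.Unary.Any using (here; there)
open import Data.List.Relation.Unary.Unique.DecPropositional ℤ._≟_ using (unique?)
open import Data.List.Relation.Unary.Unique.Propositional using (Unique)
open import Data.Nat as ℕ using (ℕ; s≤s; z≤n)
import Data.Nat.Properties as ℕ
open import Data.Product as Product using (∃-syntax; Σ-syntax; _×_; _,_; proj₁; proj₂)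
import Data.Product.Properties as Product
open import Data.Rational as ℚ using (ℚ; 0ℚ; 1ℚ)
open import Data.Rational.Literals using (fromℤ)
import Data.Rational.Properties as ℚ
import Data.Rational.Solver
open import Data.Rational.Unnormalised using (*≡*)
import Data.Rational.Unnormalised.Properties as ℚᵘ
open import Data.Sign as Sign using (Sign)
open import Data.Sum as Sum using (_⊎_; inj₁; inj₂; [_,_]′)
open import Data.Sum.Function.Propositional using (_⊎-↔_)
import Data.Sum.Properties as Sum
open import Data.Vec using (Vec; []; _∷_; lookup)
open import Function using (_∘_; _↔_; Inverse; Equivalence)
open import Function.Construct.Composition using (_↔-∘_)
open import Function.Construct.Identity using (↔-id)
open import Function.Definitions using (Injective)
open import Relation.Binary using (DecidableEquality)
open import Relation.Binary.PropositionalEquality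
open import Relation.Nullary using (¬_; Dec; yes; no; contradiction)
open import Relation.Nullary.Decidable using (⌊_⌋; toWitness; fromWitness; from-yes; ¬?; _×-dec_; _⊎-dec_; _→-dec_)
open import Relation.Unary using (Decidable)
open import Defs

open Edge using (src; tgt)
open ListAssignment using (colours; unique; size)

-- Straight-line drawings with integer coordinates

fromℤ-homo-+ : ∀ i j → fromℤ (i ℤ.+ j) ≡ fromℤ i ℚ.+ fromℤ j
fromℤ-homo-+ i j = ℚ.toℚᵘ-injective (ℚᵘ.≃-sym (ℚᵘ.≃-trans (ℚ.toℚᵘ-homo-+ (fromℤ i) (fromℤ j))
  (*≡* (cong (ℤ._* + 1) (cong₂ ℤ._+_ (ℤ.*-identityʳ i) (ℤ.*-identityʳ j))))))

fromℤ-homo-* : ∀ i j → fromℤ (i ℤ.* j) ≡ fromℤ i ℚ.* fromℤ j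
fromℤ-homo-* i j = ℚ.toℚᵘ-injective (ℚᵘ.≃-sym (ℚ.toℚᵘ-homo-* (fromℤ i) (fromℤ j)))

fromℤ-homo-neg : ∀ i → fromℤ (ℤ.- i) ≡ ℚ.- fromℤ i
fromℤ-homo-neg i = ℚ.toℚᵘ-injective (ℚᵘ.≃-sym (ℚ.toℚᵘ-homo‿- (fromℤ i)))

fromℤ-homo-- : ∀ i j → fromℤ (i ℤ.- j) ≡ fromℤ i ℚ.- fromℤ j
fromℤ-homo-- i j = trans (fromℤ-homo-+ i (ℤ.- j)) (cong (fromℤ i ℚ.+_) (fromℤ-homo-neg j))

fromℤ-injective : ∀ {i j} → fromℤ i ≡ fromℤ j → i ≡ j
fromℤ-injective = cong ℚ.numerator

fromℤ-mono-≤ : ∀ {i j} → i ℤ.≤ j → fromℤ i ℚ.≤ fromℤ j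
fromℤ-mono-≤ {i} {j} i≤j = ℚ.*≤* (subst₂ ℤ._≤_ (sym (ℤ.*-identityʳ i)) (sym (ℤ.*-identityʳ j)) i≤j)

fromℤ-mono-< : ∀ {i j} → i ℤ.< j → fromℤ i ℚ.< fromℤ j
fromℤ-mono-< {i} {j} i<j = ℚ.*<* (subst₂ ℤ._<_ (sym (ℤ.*-identityʳ i)) (sym (ℤ.*-identityʳ j)) i<j)

-- Positive iff x lies strictly to the left of the line from r to s.
turn : Point → Point → Point → ℚ
turn (r₁ , r₂) (s₁ , s₂) (x₁ , x₂) = (s₁ ℚ.- r₁) ℚ.* (x₂ ℚ.- r₂) ℚ.- (s₂ ℚ.- r₂) ℚ.* (x₁ ℚ.- r₁)

module _ where
  open Data.Rational.Solver.+-*-Solver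

  -- For fixed r and s, `turn` has degree one in the third point, and the weights 1 - t and t sum to
  -- 1.
  turn-affine : ∀ r s p q t →
    turn r s ((1ℚ ℚ.- t) ℚ.* proj₁ p ℚ.+ t ℚ.* proj₁ q , (1ℚ ℚ.- t) ℚ.* proj₂ p ℚ.+ t ℚ.* proj₂ q) ≡
    (1ℚ ℚ.- t) ℚ.* turn r s p ℚ.+ t ℚ.* turn r s q
  turn-affine (r₁ , r₂) (s₁ , s₂) (p₁ , p₂) (q₁ , q₂) = solve 9 (λ r₁ r₂ s₁ s₂ p₁ p₂ q₁ q₂ t →
    (s₁ :- r₁) :* (((con 1ℚ :- t) :* p₂ :+ t :* q₂) :- r₂) :- (s₂ :- r₂) :* (((con 1ℚ :- t) :* p₁ :+ t :* q₁) :- r₁) :=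
    (con 1ℚ :- t) :* ((s₁ :- r₁) :* (p₂ :- r₂) :- (s₂ :- r₂) :* (p₁ :- r₁)) :+ t :* ((s₁ :- r₁) :* (q₂ :- r₂) :- (s₂ :- r₂) :* (q₁ :- r₁)))
    refl r₁ r₂ s₁ s₂ p₁ p₂ q₁ q₂

  turn-self : ∀ r s → turn r s r ≡ 0ℚ
  turn-self (r₁ , r₂) (s₁ , s₂) = solve 4 (λ r₁ r₂ s₁ s₂ →
    (s₁ :- r₁) :* (r₂ :- r₂) :- (s₂ :- r₂) :* (r₁ :- r₁) := con 0ℚ) refl r₁ r₂ s₁ s₂

  turn-swap : ∀ r s x → turn s r x ≡ ℚ.- turn r s x
  turn-swap (r₁ , r₂) (s₁ , s₂) (x₁ , x₂) = solve 6 (λ r₁ r₂ s₁ s₂ x₁ x₂ →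
    (r₁ :- s₁) :* (x₂ :- s₂) :- (r₂ :- s₂) :* (x₁ :- s₁) :=
    :- ((s₁ :- r₁) :* (x₂ :- r₂) :- (s₂ :- r₂) :* (x₁ :- r₁))) refl r₁ r₂ s₁ s₂ x₁ x₂

turn-end : ∀ r s → turn r s s ≡ 0ℚ
turn-end r s = trans (turn-swap s r s) (cong ℚ.-_ (turn-self s r))

OnSegment⇒turn≡0 : ∀ r s x → OnSegment r s x → turn r s x ≡ 0ℚ
OnSegment⇒turn≡0 r s x (t , _ , _ , refl , refl) = begin
  turn r s x                                          ≡⟨ turn-affine r s r s t ⟩
  (1ℚ ℚ.- t) ℚ.* turn r s r ℚ.+ t ℚ.* turn r s s      ≡⟨ cong₂ (λ a b → (1ℚ ℚ.- t) ℚ.* a ℚ.+ t ℚ.* b) (turn-self r s) (turn-end r s) ⟩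
  (1ℚ ℚ.- t) ℚ.* 0ℚ ℚ.+ t ℚ.* 0ℚ                      ≡⟨ cong₂ ℚ._+_ (ℚ.*-zeroʳ (1ℚ ℚ.- t)) (ℚ.*-zeroʳ t) ⟩
  0ℚ                                                  ∎
  where open ≡-Reasoning

convex-positive : ∀ {t u v} → 0ℚ ℚ.< t → t ℚ.< 1ℚ →
  (0ℚ ℚ.< u × 0ℚ ℚ.≤ v) ⊎ (0ℚ ℚ.≤ u × 0ℚ ℚ.< v) → 0ℚ ℚ.< (1ℚ ℚ.- t) ℚ.* u ℚ.+ t ℚ.* v
convex-positive {t} {u} {v} 0<t t<1 =
  [ (λ (0<u , 0≤v) → ℚ.+-mono-<-≤ (positive* 0<1-t 0<u) (nonNegative* 0<t 0≤v))
  , (λ (0≤u , 0<v) → ℚ.+-mono-≤-< (nonNegative* 0<1-t 0≤u) (positive* 0<t 0<v)) ]′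
  where
  0<1-t : 0ℚ ℚ.< 1ℚ ℚ.- t
  0<1-t = subst (ℚ._< 1ℚ ℚ.- t) (ℚ.+-inverseʳ t) (ℚ.+-monoˡ-< (ℚ.- t) t<1)
  positive* : ∀ {s a} → 0ℚ ℚ.< s → 0ℚ ℚ.< a → 0ℚ ℚ.< s ℚ.* a
  positive* {s} {a} 0<s 0<a = subst (ℚ._< s ℚ.* a) (ℚ.*-zeroʳ s) (ℚ.*-monoʳ-<-pos s {{ℚ.positive 0<s}} 0<a)
  nonNegative* : ∀ {s a} → 0ℚ ℚ.< s → 0ℚ ℚ.≤ a → 0ℚ ℚ.≤ s ℚ.* a
  nonNegative* {s} {a} 0<s 0≤a = subst (ℚ._≤ s ℚ.* a) (ℚ.*-zeroʳ s)
    (ℚ.*-monoˡ-≤-nonNeg s {{ℚ.nonNegative (ℚ.<⇒≤ 0<s)}} 0≤a)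

OnLeft : (r s p q : Point) → Set
OnLeft r s p q = (0ℚ ℚ.< turn r s p × 0ℚ ℚ.≤ turn r s q) ⊎ (0ℚ ℚ.≤ turn r s p × 0ℚ ℚ.< turn r s q)

-- Since x differs from both ends, 0 < t < 1, so the end that lies strictly to the left enters the
-- convex combination with positive weight.
OnLeft⇒turn>0 : ∀ r s {p q x} → OnLeft r s p q → OnSegment p q x → x ≢ p → x ≢ q → 0ℚ ℚ.< turn r s x
OnLeft⇒turn>0 r s {p₁ , p₂} {q₁ , q₂} left (t , 0≤t , t≤1 , refl , refl) x≢p x≢q =
  subst (0ℚ ℚ.<_) (sym (turn-affine r s (p₁ , p₂) (q₁ , q₂) t))
    (convex-positive (ℚ.≰⇒> (t≢0 ∘ ℚ.≤-antisym 0≤t)) (ℚ.≰⇒> (t≢1 ∘ ℚ.≤-antisym t≤1)) left)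
  where
  at-0 : ∀ a b → (1ℚ ℚ.- 0ℚ) ℚ.* a ℚ.+ 0ℚ ℚ.* b ≡ a
  at-0 a b = trans (cong₂ ℚ._+_ (ℚ.*-identityˡ a) (ℚ.*-zeroˡ b)) (ℚ.+-identityʳ a)
  at-1 : ∀ a b → (1ℚ ℚ.- 1ℚ) ℚ.* a ℚ.+ 1ℚ ℚ.* b ≡ b
  at-1 a b = trans (cong₂ ℚ._+_ (ℚ.*-zeroˡ a) (ℚ.*-identityˡ b)) (ℚ.+-identityˡ b)
  t≢0 : 0ℚ ≢ t
  t≢0 refl = x≢p (cong₂ _,_ (at-0 p₁ q₁) (at-0 p₂ q₂))
  t≢1 : t ≢ 1ℚ
  t≢1 refl = x≢q (cong₂ _,_ (at-1 p₁ q₁) (at-1 p₂ q₂))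

OnOneSide : (r s p q : Point) → Set
OnOneSide r s p q = OnLeft r s p q ⊎ OnLeft s r p q

-- `turn` vanishes on the segment from r to s but has a strict sign inside the segment from p to q.
-- Exchanging r and s reduces the right side to the left.
OnOneSide⇒disjoint : ∀ {r s p q x} → OnOneSide r s p q → OnSegment p q x → x ≢ p → x ≢ q → ¬ OnSegment r s x
OnOneSide⇒disjoint {r} {s} {x = x} (inj₁ left) on x≢p x≢q on′ =
  ℚ.<-irrefl (sym (OnSegment⇒turn≡0 r s x on′)) (OnLeft⇒turn>0 r s left on x≢p x≢q)
OnOneSide⇒disjoint {r} {s} {x = x} (inj₂ left) on x≢p x≢q on′ =
  ℚ.<-irrefl (sym (trans (turn-swap r s x) (cong ℚ.-_ (OnSegment⇒turn≡0 r s x on′)))) (OnLeft⇒turn>0 s r left on x≢p x≢q)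

-- Side tests in integer arithmetic

Site : Set
Site = ℤ × ℤ

point : Site → Point
point (a , b) = fromℤ a , fromℤ b

turnℤ : Site → Site → Site → ℤ
turnℤ (r₁ , r₂) (s₁ , s₂) (x₁ , x₂) = (s₁ ℤ.- r₁) ℤ.* (x₂ ℤ.- r₂) ℤ.- (s₂ ℤ.- r₂) ℤ.* (x₁ ℤ.- r₁)

-- Turns side conditions on the drawing into integer inequalities, which are decided by evaluation.
turn-point : ∀ r s x → turn (point r) (point s) (point x) ≡ fromℤ (turnℤ r s x)
turn-point (r₁ , r₂) (s₁ , s₂) (x₁ , x₂) = sym (trans
  (fromℤ-homo-- ((s₁ ℤ.- r₁) ℤ.* (x₂ ℤ.- r₂)) ((s₂ ℤ.- r₂) ℤ.* (x₁ ℤ.- r₁)))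
  (cong₂ ℚ._-_ (product s₁ r₁ x₂ r₂) (product s₂ r₂ x₁ r₁)))
  where
  product : ∀ a b c d → fromℤ ((a ℤ.- b) ℤ.* (c ℤ.- d)) ≡ (fromℤ a ℚ.- fromℤ b) ℚ.* (fromℤ c ℚ.- fromℤ d)
  product a b c d = trans (fromℤ-homo-* (a ℤ.- b) (c ℤ.- d)) (cong₂ ℚ._*_ (fromℤ-homo-- a b) (fromℤ-homo-- c d))

OnLeftℤ : (r s p q : Site) → Set
OnLeftℤ r s p q = (+ 0 ℤ.< turnℤ r s p × + 0 ℤ.≤ turnℤ r s q) ⊎ (+ 0 ℤ.≤ turnℤ r s p × + 0 ℤ.< turnℤ r s q)

OnLeftℤ? : ∀ r s p q → Dec (OnLeftℤ r s p q)
OnLeftℤ? r s p q = ((+ 0 ℤ.<? turnℤ r s p) ×-dec (+ 0 ℤ.≤? turnℤ r s q)) ⊎-dec ((+ 0 ℤ.≤? turnℤ r s p) ×-dec (+ 0 ℤ.<? turnℤ r s q))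

OnLeft-point : ∀ {r s p q} → OnLeftℤ r s p q → OnLeft (point r) (point s) (point p) (point q)
OnLeft-point {r} {s} {p} {q} rewrite turn-point r s p | turn-point r s q =
  Sum.map (Product.map fromℤ-mono-< fromℤ-mono-≤) (Product.map fromℤ-mono-≤ fromℤ-mono-<)

OnOneSideℤ : (r s p q : Site) → Set
OnOneSideℤ r s p q = OnLeftℤ r s p q ⊎ OnLeftℤ s r p q

OnOneSideℤ? : ∀ r s p q → Dec (OnOneSideℤ r s p q)
OnOneSideℤ? r s p q = OnLeftℤ? r s p q ⊎-dec OnLeftℤ? s r p q

OnOneSide-point : ∀ r s p q → OnOneSideℤ r s p q → OnOneSide (point r) (point s) (point p) (point q)
OnOneSide-point r s p q = Sum.map (OnLeft-point {r} {s} {p} {q}) (OnLeft-point {s} {r} {p} {q})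

point-injective : ∀ {p q} → point p ≡ point q → p ≡ q
point-injective eq = cong₂ _,_ (fromℤ-injective (cong proj₁ eq)) (fromℤ-injective (cong proj₂ eq))

edge-ext : ∀ {G} {e f : Edge G} → src e ≡ src f → tgt e ≡ tgt f → e ≡ f
edge-ext {e = edge s t p a} {edge s t p′ a′} refl refl = cong₂ (edge s t) (ℕ.≤-irrelevant p p′) (T-irrelevant a a′)

module _ {G : Graph} (site : Graph.Vertex G → Site) where
  open Graph G using (Vertex)

  -- A third vertex has to avoid the whole line through the edge, which is a single determinant
  -- test.
  NotThrough : Vertex → Vertex → Vertex → Set
  NotThrough u v w = turnℤ (site u) (site v) (site w) ≢ + 0 ⊎ (w ≡ u ⊎ w ≡ v)

  -- The line through either edge may be the separating one. The last case is an edge compared with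
  -- itself.
  NonCrossing : Vertex × Vertex → Vertex × Vertex → Set
  NonCrossing (u , v) (u′ , v′) =
      OnOneSideℤ (site u′) (site v′) (site u) (site v)
    ⊎ OnOneSideℤ (site u) (site v) (site u′) (site v′)
    ⊎ (u ≡ u′ × v ≡ v′)

  straight-line-drawing :
    Injective _≡_ _≡_ site →
    (∀ (e : Edge G) w → NotThrough (src e) (tgt e) w) →
    (∀ (e f : Edge G) → NonCrossing (src e , tgt e) (src f , tgt f)) →
    Planar G
  straight-line-drawing site-injective not-through non-crossing = record
    { pos           = pos
    ; bends         = λ _ → []
    ; pos-injective = site-injective ∘ point-injective
    -- Without bends an arc is one segment, and it is simple as soon as its ends differ.
    ; arc-simple    = λ e eq → Fin.<⇒≢ (Edge.src<tgt e) (site-injective (point-injective eq))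
    ; avoids-vertex = λ { e x (inj₁ on , x≢s , x≢t) v → avoids-vertex e x on x≢s x≢t v }
    ; avoids-edge   = λ { e x (inj₁ on , x≢s , x≢t) f f≢e (inj₁ on′) → avoids-edge e x on x≢s x≢t f f≢e on′ }
    }
    where
    pos : Vertex → Point
    pos = point ∘ site

    _≟_ : (p q : Point) → Dec (p ≡ q)
    _≟_ = Product.≡-dec ℚ._≟_ ℚ._≟_

    avoids-vertex : ∀ (e : Edge G) x → OnSegment (pos (src e)) (pos (tgt e)) x →
      x ≢ pos (src e) → x ≢ pos (tgt e) → ∀ v → x ≢ pos v
    avoids-vertex e x on x≢s x≢t v refl with not-through e v
    ... | inj₁ turn≢0       = turn≢0 (fromℤ-injective (trans
            (sym (turn-point (site (src e)) (site (tgt e)) (site v)))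
            (OnSegment⇒turn≡0 (pos (src e)) (pos (tgt e)) x on)))
    ... | inj₂ (inj₁ refl)  = x≢s refl
    ... | inj₂ (inj₂ refl)  = x≢t refl

    avoids-edge : ∀ (e : Edge G) x → OnSegment (pos (src e)) (pos (tgt e)) x →
      x ≢ pos (src e) → x ≢ pos (tgt e) → ∀ f → f ≢ e → ¬ OnSegment (pos (src f)) (pos (tgt f)) x
    -- A common point that is an endpoint of f is a vertex on e, so only interior points of both need non-crossing.
    avoids-edge e x on x≢s x≢t f f≢e on′ with x ≟ pos (src f) | x ≟ pos (tgt f)
    ... | yes eq | _      = avoids-vertex e x on x≢s x≢t (src f) eq
    ... | no _   | yes eq = avoids-vertex e x on x≢s x≢t (tgt f) eq
    ... | no x≢s′ | no x≢t′ with non-crossing e f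
    ...   | inj₁ side               = OnOneSide⇒disjoint (OnOneSide-point (site (src f)) (site (tgt f)) (site (src e)) (site (tgt e)) side) on x≢s x≢t on′
    ...   | inj₂ (inj₁ side)        = OnOneSide⇒disjoint (OnOneSide-point (site (src e)) (site (tgt e)) (site (src f)) (site (tgt f)) side) on′ x≢s′ x≢t′ on
    ...   | inj₂ (inj₂ (eq₁ , eq₂)) = f≢e (edge-ext (sym eq₁) (sym eq₂))

-- The graph

Node : Set
Node = Fin 2 ⊎ Fin 10 ⊎ Fin 9 × Fin 4

pattern pole p = inj₁ p
pattern post i = inj₂ (inj₁ i)
pattern ring k j = inj₂ (inj₂ (k , j))

_≟_ : DecidableEquality Node
_≟_ = Sum.≡-dec Fin._≟_ (Sum.≡-dec Fin._≟_ (Product.≡-dec Fin._≟_ Fin._≟_))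

order : ℕ
order = 2 ℕ.+ (10 ℕ.+ 9 ℕ.* 4)

nodes : Fin order ↔ Node
nodes = (↔-id _ ⊎-↔ ((↔-id _ ⊎-↔ Fin.*↔×) ↔-∘ Fin.+↔⊎)) ↔-∘ Fin.+↔⊎

open Inverse nodes using () renaming (to to node; from to code; strictlyInverseˡ to node-code; strictlyInverseʳ to code-node)

-- Cyclic order around the cell. Post k + 1 is corner 3 of cell k and corner 1 of the next cell, if
-- there is one.
corner : Fin 9 → Fin 4 → Node
corner k 0F = pole 0F
corner k 1F = post (inject₁ k)
corner k 2F = pole 1F
corner k 3F = post (suc k)

consecutive : Fin 4 → Fin 4 → Bool
consecutive 0F 1F = true
consecutive 1F 2F = true
consecutive 2F 3F = true
consecutive 0F 3F = true
consecutive _  _  = false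

infix 4 _⟶_

-- Each edge gets one direction, from the smaller code to the larger, to match the increasing
-- enumeration in `Edge`. This is why the closing edge of a rim runs from 0 to 3.
data _⟶_ : Node → Node → Set where
  axis  : ∀ p i → pole p ⟶ post i
  spoke : ∀ k j → corner k j ⟶ ring k j
  rim   : ∀ k i j → T (consecutive i j) → ring k i ⟶ ring k j

joins : Node → Node → Bool
joins (pole _)   (post _)   = true
joins (ring k i) (ring l j) = ⌊ k Fin.≟ l ⌋ ∧ consecutive i j
-- Here u is a pole or a post, as pairs of rings are caught by the clause before.
joins u          (ring k j) = ⌊ u ≟ corner k j ⌋
joins _          _          = false

joins⇒⟶ : ∀ u v → T (joins u v) → u ⟶ v
joins⇒⟶ (pole p)   (post i)   _ = axis p i
joins⇒⟶ (pole p)   (ring k j) h = subst (_⟶ ring k j) (sym (toWitness {a? = pole p ≟ corner k j} h)) (spoke k j)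
joins⇒⟶ (post i)   (ring k j) h = subst (_⟶ ring k j) (sym (toWitness {a? = post i ≟ corner k j} h)) (spoke k j)
joins⇒⟶ (ring k i) (ring l j) h with Equivalence.to (T-∧ {⌊ k Fin.≟ l ⌋}) h
... | k≡l , ij with refl ← toWitness {a? = k Fin.≟ l} k≡l = rim k i j ij

⟶⇒joins : ∀ {u v} → u ⟶ v → T (joins u v)
⟶⇒joins (axis p i)     = _
⟶⇒joins (spoke k 0F)   = _
⟶⇒joins (spoke k 1F)   = fromWitness {a? = post (inject₁ k) ≟ post (inject₁ k)} refl
⟶⇒joins (spoke k 2F)   = _
⟶⇒joins (spoke k 3F)   = fromWitness {a? = post (suc k) ≟ post (suc k)} refl
⟶⇒joins (rim k i j ij) = Equivalence.from (T-∧ {⌊ k Fin.≟ k ⌋}) (fromWitness {a? = k Fin.≟ k} refl , ij)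

-- A bipartition, which rules out loops and triangles. Corners alternate around a cell, and each
-- ring vertex takes the class opposite to that of its corner.
side : Node → Bool
side (pole _)    = true
side (post _)    = false
side (ring _ 0F) = false
side (ring _ 1F) = true
side (ring _ 2F) = false
side (ring _ 3F) = true

⟶⇒side : ∀ {u v} → u ⟶ v → side u ≢ side v
⟶⇒side (axis p i)   ()
⟶⇒side (spoke k 0F) ()
⟶⇒side (spoke k 1F) ()
⟶⇒side (spoke k 2F) ()
⟶⇒side (spoke k 3F) ()
⟶⇒side (rim k 0F 1F _) ()
⟶⇒side (rim k 1F 2F _) ()
⟶⇒side (rim k 2F 3F _) ()
⟶⇒side (rim k 0F 3F _) ()

-- Codes run through the poles, then the posts, then the rings cell by cell.
⟶⇒code< : ∀ {u v} → u ⟶ v → code u Fin.< code v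
⟶⇒code< (axis p i)  = from-yes (Fin.all? λ p → Fin.all? λ i → code (pole p) Fin.<? code (post i)) p i
⟶⇒code< (spoke k j) = from-yes (Fin.all? λ k → Fin.all? λ j → code (corner k j) Fin.<? code (ring k j)) k j
⟶⇒code< (rim k 0F 1F _) = from-yes (Fin.all? λ k → code (ring k 0F) Fin.<? code (ring k 1F)) k
⟶⇒code< (rim k 1F 2F _) = from-yes (Fin.all? λ k → code (ring k 1F) Fin.<? code (ring k 2F)) k
⟶⇒code< (rim k 2F 3F _) = from-yes (Fin.all? λ k → code (ring k 2F) Fin.<? code (ring k 3F)) k
⟶⇒code< (rim k 0F 3F _) = from-yes (Fin.all? λ k → code (ring k 0F) Fin.<? code (ring k 3F)) k

adj : Fin order → Fin order → Bool
adj u v = joins (node u) (node v) ∨ joins (node v) (node u)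

adj⇒⟶ : ∀ u v → T (adj u v) → node u ⟶ node v ⊎ node v ⟶ node u
adj⇒⟶ u v = Sum.map (joins⇒⟶ (node u) (node v)) (joins⇒⟶ (node v) (node u)) ∘ Equivalence.to (T-∨ {joins (node u) (node v)})

adj⇒side : ∀ u v → T (adj u v) → side (node u) ≢ side (node v)
adj⇒side u v = [ ⟶⇒side , (λ v⟶u → ⟶⇒side v⟶u ∘ sym) ]′ ∘ adj⇒⟶ u v

G : Graph
G = record
  { order  = order
  ; adj    = adj
  ; sym    = λ {u} {v} → subst T (∨-comm (joins (node u) (node v)) (joins (node v) (node u)))
  ; irrefl = λ {v} a → adj⇒side v v a refl
  }

open Graph G using (Vertex)

⟶⇒edge : ∀ {u v} → u ⟶ v → Edge G
⟶⇒edge {u} {v} u⟶v = edge (code u) (code v) (⟶⇒code< u⟶v)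
  (subst₂ (λ a b → T (joins a b ∨ joins b a)) (sym (node-code u)) (sym (node-code v))
    (Equivalence.from (T-∨ {joins u v}) (inj₁ (⟶⇒joins u⟶v))))

-- Girth

girth : HasGirth G 4
girth = 4-cycle , λ k C → ℕ.≤∧≢⇒< (Cycle.3≤k C) λ { refl → no-triangle C }
  where
  4-cycle : Cycle G 4
  4-cycle = record
    { 3≤k      = s≤s (s≤s (s≤s z≤n))
    ; vertex   = code ∘ corner 0F
    ; distinct = λ {i} {j} → from-yes (Fin.all? λ i → Fin.all? λ j → (code (corner 0F i) Fin.≟ code (corner 0F j)) →-dec (i Fin.≟ j)) i j
    ; step     = from-yes (Fin.all? λ i → Fin.all? λ j → (toℕ j ℕ.≟ ℕ.suc (toℕ i)) →-dec T? (adj (code (corner 0F i)) (code (corner 0F j))))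
    ; close    = from-yes (Fin.all? λ i → Fin.all? λ j → (ℕ.suc (toℕ i) ℕ.≟ 4) →-dec (toℕ j ℕ.≟ 0) →-dec T? (adj (code (corner 0F i)) (code (corner 0F j))))
    }

  no-triangle : ¬ Cycle G 3
  no-triangle C = bool-pigeonhole (side (node (vertex 0F))) (side (node (vertex 1F))) (side (node (vertex 2F)))
    (adj⇒side (vertex 0F) (vertex 1F) (step 0F 1F refl))
    (adj⇒side (vertex 1F) (vertex 2F) (step 1F 2F refl))
    (adj⇒side (vertex 2F) (vertex 0F) (close 2F 0F refl refl))
    where
    open Cycle C
    bool-pigeonhole : ∀ a b c → a ≢ b → b ≢ c → c ≢ a → ⊥
    bool-pigeonhole a b c a≢b b≢c c≢a = c≢a (trans (¬-not (b≢c ∘ sym)) (sym (¬-not a≢b)))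

-- Planarity

-- The ring vertices are kept off the line through the posts, so that no line through an edge contains a third vertex.
site : Node → Site
site (pole 0F)   = + 19 , + 30
site (pole 1F)   = + 19 , - + 30
site (post i)    = + (4 ℕ.* toℕ i) , + 0
site (ring k 0F) = + (4 ℕ.* toℕ k ℕ.+ 2) , + 3
site (ring k 1F) = + (4 ℕ.* toℕ k ℕ.+ 1) , - + 1
site (ring k 2F) = + (4 ℕ.* toℕ k ℕ.+ 2) , - + 3
site (ring k 3F) = + (4 ℕ.* toℕ k ℕ.+ 3) , - + 1

isEdge? : (e : Vertex × Vertex) → Dec (proj₁ e Fin.< proj₂ e × T (adj (proj₁ e) (proj₂ e)))
isEdge? (u , v) = (u Fin.<? v) ×-dec T? (adj u v)

-- Bare pairs of endpoints, so that the conditions on a drawing become checks over an explicit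
-- finite list.
edges : List (Vertex × Vertex)
edges = filter isEdge? (cartesianProduct (allFin order) (allFin order))

∈-edges : (e : Edge G) → (src e , tgt e) ∈ edges
∈-edges (edge u v u<v a) = ∈-filter⁺ isEdge? (∈-cartesianProduct⁺ (∈-allFin u) (∈-allFin v)) (u<v , a)

NotThrough? : ∀ u v w → Dec (NotThrough {G} (site ∘ node) u v w)
NotThrough? u v w = ¬? (turnℤ (site (node u)) (site (node v)) (site (node w)) ℤ.≟ + 0) ⊎-dec ((w Fin.≟ u) ⊎-dec (w Fin.≟ v))

NonCrossing? : ∀ e f → Dec (NonCrossing {G} (site ∘ node) e f)
NonCrossing? (u , v) (u′ , v′) =
      OnOneSideℤ? (site (node u′)) (site (node v′)) (site (node u)) (site (node v))
    ⊎-dec OnOneSideℤ? (site (node u)) (site (node v)) (site (node u′)) (site (node v′))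
    ⊎-dec ((u Fin.≟ u′) ×-dec (v Fin.≟ v′))

allPairs? : ∀ {A : Set} {R : A → A → Set} → (∀ x y → Dec (R x y)) → (xs : List A) → Dec (All (λ x → All (R x) xs) xs)
allPairs? R? xs = All.all? (λ x → All.all? (R? x) xs) xs

abstract
  site-injective : ∀ u v → site (node u) ≡ site (node v) → u ≡ v
  site-injective = from-yes (Fin.all? λ u → Fin.all? λ v → Product.≡-dec ℤ._≟_ ℤ._≟_ (site (node u)) (site (node v)) →-dec (u Fin.≟ v))

  not-through : All (λ e → ∀ w → NotThrough {G} (site ∘ node) (proj₁ e) (proj₂ e) w) edges
  not-through = from-yes (All.all? (λ e → Fin.all? λ w → NotThrough? (proj₁ e) (proj₂ e) w) edges)

  non-crossing : All (λ e → All (NonCrossing {G} (site ∘ node) e) edges) edges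
  non-crossing = from-yes (allPairs? NonCrossing? edges)

planar : Planar G
planar = straight-line-drawing (site ∘ node) (site-injective _ _)
  (λ e → All.lookup not-through (∈-edges e))
  (λ e f → All.lookup (All.lookup non-crossing (∈-edges e)) (∈-edges f))

-- Unsigned colourings

avoid-two : ∀ {xs : List ℤ} → Unique xs → length xs ≡ 3 → ∀ a b → ∃[ c ] c ∈ xs × c ≢ a × c ≢ b
avoid-two {p ∷ q ∷ r ∷ []} ((p≢q ∷ p≢r ∷ []) ∷ (q≢r ∷ []) ∷ _) refl a b with p ℤ.≟ a | p ℤ.≟ b | q ℤ.≟ a | q ℤ.≟ b
... | no p≢a   | no p≢b   | _        | _        = p , here refl , p≢a , p≢b
... | yes refl | _        | _        | no q≢b   = q , there (here refl) , p≢q ∘ sym , q≢b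
... | yes refl | _        | _        | yes refl = r , there (there (here refl)) , p≢r ∘ sym , q≢r ∘ sym
... | no _     | yes refl | no q≢a   | _        = q , there (here refl) , q≢a , p≢q ∘ sym
... | no _     | yes refl | yes refl | _        = r , there (there (here refl)) , q≢r ∘ sym , p≢r ∘ sym

-- Take p available at vertex 0.  If some vertex i ∈ {0, 1} has p available but vertex i + 1 has not, colour i with p and
-- continue greedily the other way round to i + 1; otherwise p is available at both 0 and 2.
C₄-2-choosable : {P : Fin 4 → ℤ → Set} → (∀ j → Decidable (P j)) → (∀ j d → ∃[ c ] P j c × c ≢ d) →
  Σ[ c ∈ (Fin 4 → ℤ) ] (∀ j → P j (c j)) × c 0F ≢ c 1F × c 1F ≢ c 2F × c 2F ≢ c 3F × c 0F ≢ c 3F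
-- The 0 is a dummy: any available colour will do for p.
C₄-2-choosable {P} P? other with other 0F (+ 0)
... | p , P₀p , _ with P? 1F p
C₄-2-choosable {P} P? other | p , P₀p , _ | no ¬P₁p
  with c₃ , P₃c₃ , c₃≢p ← other 3F p
  with c₂ , P₂c₂ , c₂≢c₃ ← other 2F c₃
  with c₁ , P₁c₁ , c₁≢c₂ ← other 1F c₂
  = lookup (p ∷ c₁ ∷ c₂ ∷ c₃ ∷ []) , (λ { 0F → P₀p ; 1F → P₁c₁ ; 2F → P₂c₂ ; 3F → P₃c₃ })
  , (λ { refl → ¬P₁p P₁c₁ }) , c₁≢c₂ , c₂≢c₃ , c₃≢p ∘ sym
C₄-2-choosable {P} P? other | p , P₀p , _ | yes P₁p with P? 2F p
... | no ¬P₂p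
  with c₀ , P₀c₀ , c₀≢p ← other 0F p
  with c₃ , P₃c₃ , c₃≢c₀ ← other 3F c₀
  with c₂ , P₂c₂ , c₂≢c₃ ← other 2F c₃
  = lookup (c₀ ∷ p ∷ c₂ ∷ c₃ ∷ []) , (λ { 0F → P₀c₀ ; 1F → P₁p ; 2F → P₂c₂ ; 3F → P₃c₃ })
  , c₀≢p , (λ { refl → ¬P₂p P₂c₂ }) , c₂≢c₃ , c₃≢c₀ ∘ sym
... | yes P₂p
  with c₁ , P₁c₁ , c₁≢p ← other 1F p
  with c₃ , P₃c₃ , c₃≢p ← other 3F p
  = lookup (p ∷ c₁ ∷ p ∷ c₃ ∷ []) , (λ { 0F → P₀p ; 1F → P₁c₁ ; 2F → P₂p ; 3F → P₃c₃ })
  , c₁≢p ∘ sym , c₁≢p , c₃≢p ∘ sym , c₃≢p ∘ sym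

choosable : Choosable G 3
choosable L = c , proper , λ v → subst (λ u → c v ∈ colours L u) (code-node v) (colour∈ (node v))
  where
  pick : ∀ u a b → ∃[ c ] c ∈ colours L (code u) × c ≢ a × c ≢ b
  pick u = avoid-two (unique L (code u)) (size L (code u))

  poleColour : ∀ p → ∃[ c ] c ∈ colours L (code (pole p))
  poleColour p = let c , c∈ , _ = pick (pole p) (+ 0) (+ 0) in c , c∈

  postColour : ∀ i → ∃[ c ] c ∈ colours L (code (post i)) × c ≢ proj₁ (poleColour 0F) × c ≢ proj₁ (poleColour 1F)
  postColour i = pick (post i) (proj₁ (poleColour 0F)) (proj₁ (poleColour 1F))

  -- Equals `colour (corner k j)`, but is defined before `colour`, which depends on it through
  -- `ringColour`.
  cornerChoice : Fin 9 → Fin 4 → ℤ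
  cornerChoice k 0F = proj₁ (poleColour 0F)
  cornerChoice k 1F = proj₁ (postColour (inject₁ k))
  cornerChoice k 2F = proj₁ (poleColour 1F)
  cornerChoice k 3F = proj₁ (postColour (suc k))

  Available : Fin 9 → Fin 4 → ℤ → Set
  Available k j c = c ∈ colours L (code (ring k j)) × cornerChoice k j ≢ c

  ringColour : ∀ k → Σ[ c ∈ (Fin 4 → ℤ) ] (∀ j → Available k j (c j)) × c 0F ≢ c 1F × c 1F ≢ c 2F × c 2F ≢ c 3F × c 0F ≢ c 3F
  ringColour k = C₄-2-choosable {Available k}
    (λ j c → (c ∈? colours L (code (ring k j))) ×-dec ¬? (cornerChoice k j ℤ.≟ c))
    -- Three colours still leave one after the corner's colour and d are removed.
    (λ j d → let c , c∈ , c≢corner , c≢d = pick (ring k j) (cornerChoice k j) d in c , (c∈ , c≢corner ∘ sym) , c≢d)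

  colour : Node → ℤ
  colour (pole p)   = proj₁ (poleColour p)
  colour (post i)   = proj₁ (postColour i)
  colour (ring k j) = proj₁ (ringColour k) j

  colour∈ : ∀ u → colour u ∈ colours L (code u)
  colour∈ (pole p)   = proj₂ (poleColour p)
  colour∈ (post i)   = proj₁ (proj₂ (postColour i))
  colour∈ (ring k j) = proj₁ (proj₁ (proj₂ (ringColour k)) j)

  colour-proper : ∀ {u v} → u ⟶ v → colour u ≢ colour v
  colour-proper (axis 0F i) = proj₁ (proj₂ (proj₂ (postColour i))) ∘ sym
  colour-proper (axis 1F i) = proj₂ (proj₂ (proj₂ (postColour i))) ∘ sym
  colour-proper (spoke k j) = subst (_≢ proj₁ (ringColour k) j) (cornerChoice≡ j) (proj₂ (proj₁ (proj₂ (ringColour k)) j))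
    where
    cornerChoice≡ : ∀ j → cornerChoice k j ≡ colour (corner k j)
    cornerChoice≡ 0F = refl
    cornerChoice≡ 1F = refl
    cornerChoice≡ 2F = refl
    cornerChoice≡ 3F = refl
  colour-proper (rim k 0F 1F _) = let _ , _ , c₀≢c₁ , _ = ringColour k in c₀≢c₁
  colour-proper (rim k 1F 2F _) = let _ , _ , _ , c₁≢c₂ , _ = ringColour k in c₁≢c₂
  colour-proper (rim k 2F 3F _) = let _ , _ , _ , _ , c₂≢c₃ , _ = ringColour k in c₂≢c₃
  colour-proper (rim k 0F 3F _) = let _ , _ , _ , _ , _ , c₀≢c₃ = ringColour k in c₀≢c₃

  c : Vertex → ℤ
  c = colour ∘ node

  proper : IsProper G c
  proper (edge u v _ a) = [ colour-proper , (λ v⟶u → colour-proper v⟶u ∘ sym) ]′ (adj⇒⟶ u v a)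

-- Signed colourings

-- One negative edge in each inner 4-cycle makes the product of its signs -1. Cell indices need no
-- comparison, as an edge between two rings stays within one cell.
sign : Node → Node → Sign
sign (ring _ 0F) (ring _ 1F) = Sign.-
sign _           _           = Sign.+

σ : Signature G
σ e = sign (node (src e)) (node (tgt e))

-- Row k: the colours of the four corners of cell k in the situation that cell k excludes.  Consecutive rows share the
-- colour of one pole, so the colours of both situations at post k + 1 fit in one list of three.
cornerColours : Vec (Vec ℤ 4) 9
cornerColours =
    (+ 1 ∷ + 3 ∷ + 4 ∷ + 5 ∷ [])
  ∷ (+ 1 ∷ + 4 ∷ + 5 ∷ + 6 ∷ [])
  ∷ (+ 1 ∷ + 5 ∷ + 6 ∷ + 2 ∷ [])
  ∷ (+ 2 ∷ + 1 ∷ + 6 ∷ + 4 ∷ [])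
  ∷ (+ 2 ∷ + 6 ∷ + 4 ∷ + 5 ∷ [])
  ∷ (+ 2 ∷ + 4 ∷ + 5 ∷ + 3 ∷ [])
  ∷ (+ 3 ∷ + 2 ∷ + 5 ∷ + 6 ∷ [])
  ∷ (+ 3 ∷ + 5 ∷ + 6 ∷ + 4 ∷ [])
  ∷ (+ 3 ∷ + 6 ∷ + 4 ∷ + 1 ∷ [])
  ∷ []

cornerColour : Fin 9 → Fin 4 → ℤ
cornerColour k j = lookup (lookup cornerColours k) j

-- Post 0 takes its list from row 0 as corner 1, every later post from the row of the preceding cell
-- as corner 3. A ring vertex is left with 7 and -7 once its corner has the colour of the row.
palette : Node → List ℤ
palette (pole 0F)   = + 1 ∷ + 2 ∷ + 3 ∷ []
palette (pole 1F)   = + 4 ∷ + 5 ∷ + 6 ∷ []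
palette (post 0F)   = cornerColour 0F 0F ∷ cornerColour 0F 1F ∷ cornerColour 0F 2F ∷ []
palette (post (suc k)) = cornerColour k 0F ∷ cornerColour k 2F ∷ cornerColour k 3F ∷ []
palette (ring k j)  = + 7 ∷ - + 7 ∷ cornerColour k j ∷ []

lists : ListAssignment G 3
lists = record
  { colours  = palette ∘ node
  ; unique   = from-yes (Fin.all? λ v → unique? (palette (node v)))
  ; nonempty = λ v eq → contradiction (trans (sym (three v)) (cong length eq)) λ ()
  ; size     = three
  }
  where
  three : ∀ v → length (palette (node v)) ≡ 3
  three = from-yes (Fin.all? λ v → length (palette (node v)) ℕ.≟ 3)

every-pair-excluded : ∀ {a b} → a ∈ palette (pole 0F) → b ∈ palette (pole 1F) →
  ∃[ k ] a ≡ cornerColour k 0F × b ≡ cornerColour k 2F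
every-pair-excluded a∈ b∈ = All.lookup (All.lookup (from-yes
  (All.all? (λ a → All.all? (λ b → Fin.any? λ k → (a ℤ.≟ cornerColour k 0F) ×-dec (b ℤ.≟ cornerColour k 2F))
    (palette (pole 1F))) (palette (pole 0F)))) a∈) b∈

-- For k > 0 the list of post k is written with row k - 1. That it also serves row k is what the
-- order of the rows achieves.
post-palette : ∀ k → All (λ c → c ≡ cornerColour k 0F ⊎ c ≡ cornerColour k 2F ⊎ c ≡ cornerColour k 1F) (palette (post (inject₁ k)))
post-palette = from-yes (Fin.all? λ k → All.all? (λ c → (c ℤ.≟ cornerColour k 0F) ⊎-dec (c ℤ.≟ cornerColour k 2F) ⊎-dec (c ℤ.≟ cornerColour k 1F)) (palette (post (inject₁ k))))

-- On ±7 the negative edge forces equality and the other three edges force a change of sign.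
unbalanced-C₄ : ∀ {a b c d} → a ≡ + 7 ⊎ a ≡ - + 7 → b ≡ + 7 ⊎ b ≡ - + 7 → c ≡ + 7 ⊎ c ≡ - + 7 → d ≡ + 7 ⊎ d ≡ - + 7 →
  a ≢ (Sign.- ◃ 1) ℤ.* b → b ≢ c → c ≢ d → a ≢ d → ⊥
unbalanced-C₄ (inj₁ refl) (inj₂ refl) _           _           ab _  _  _  = ab refl
unbalanced-C₄ (inj₂ refl) (inj₁ refl) _           _           ab _  _  _  = ab refl
unbalanced-C₄ _           (inj₁ refl) (inj₁ refl) _           _  bc _  _  = bc refl
unbalanced-C₄ _           (inj₂ refl) (inj₂ refl) _           _  bc _  _  = bc refl
unbalanced-C₄ _           _           (inj₁ refl) (inj₁ refl) _  _  cd _  = cd refl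
unbalanced-C₄ _           _           (inj₂ refl) (inj₂ refl) _  _  cd _  = cd refl
unbalanced-C₄ (inj₁ refl) _           _           (inj₁ refl) _  _  _  ad = ad refl
unbalanced-C₄ (inj₂ refl) _           _           (inj₂ refl) _  _  _  ad = ad refl

-- The two pole colours leave each post of the cell only the colour of row k. The four corners then
-- remove their colours from the ring lists, and an unbalanced 4-cycle has to be coloured from 7 and
-- -7.
cell-excludes : ∀ (c : Node → ℤ) k → (∀ u → c u ∈ palette u) → (∀ {u v} → u ⟶ v → c u ≢ (sign u v ◃ 1) ℤ.* c v) →
  c (pole 0F) ≡ cornerColour k 0F → c (pole 1F) ≡ cornerColour k 2F → ⊥
cell-excludes c k c∈ proper eq₀ eq₂ =
  unbalanced-C₄ (ring-colour 0F) (ring-colour 1F) (ring-colour 2F) (ring-colour 3F)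
    (proper (rim k 0F 1F _)) (proper⁺ (rim k 1F 2F _) refl) (proper⁺ (rim k 2F 3F _) refl) (proper⁺ (rim k 0F 3F _) refl)
  where
  proper⁺ : ∀ {u v} → u ⟶ v → sign u v ≡ Sign.+ → c u ≢ c v
  proper⁺ {u} {v} u⟶v positive eq = proper u⟶v
    (trans eq (sym (trans (cong (λ s → (s ◃ 1) ℤ.* c v) positive) (ℤ.*-identityˡ (c v)))))

  post-colour : ∀ i {d} → c (post i) ≡ cornerColour k 0F ⊎ c (post i) ≡ cornerColour k 2F ⊎ c (post i) ≡ d → c (post i) ≡ d
  post-colour i (inj₁ eq)        = contradiction (trans eq₀ (sym eq)) (proper⁺ (axis 0F i) refl)
  post-colour i (inj₂ (inj₁ eq)) = contradiction (trans eq₂ (sym eq)) (proper⁺ (axis 1F i) refl)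
  post-colour i (inj₂ (inj₂ eq)) = eq

  corner-colour : ∀ j → c (corner k j) ≡ cornerColour k j
  corner-colour 0F = eq₀
  corner-colour 1F = post-colour (inject₁ k) (All.lookup (post-palette k) (c∈ (post (inject₁ k))))
  corner-colour 2F = eq₂
  -- This list is row k by definition, whereas corner 1 had to go through `post-palette`.
  corner-colour 3F with c∈ (post (suc k))
  ... | here eq                 = post-colour (suc k) (inj₁ eq)
  ... | there (here eq)         = post-colour (suc k) (inj₂ (inj₁ eq))
  ... | there (there (here eq)) = eq

  spoke-positive : ∀ j → sign (corner k j) (ring k j) ≡ Sign.+
  spoke-positive 0F = refl
  spoke-positive 1F = refl
  spoke-positive 2F = refl
  spoke-positive 3F = refl

  ring-colour : ∀ j → c (ring k j) ≡ + 7 ⊎ c (ring k j) ≡ - + 7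
  ring-colour j with c∈ (ring k j)
  ... | here eq                 = inj₁ eq
  ... | there (here eq)         = inj₂ eq
  ... | there (there (here eq)) = contradiction (trans (corner-colour j) (sym eq)) (proper⁺ (spoke k j) (spoke-positive j))

not-signed-choosable : ¬ SignedChoosable G σ 3
not-signed-choosable choose =
  let k , eq₀ , eq₂ = every-pair-excluded (c∈ (pole 0F)) (c∈ (pole 1F)) in cell-excludes c k c∈ proper eq₀ eq₂
  where
  c : Node → ℤ
  c = proj₁ (choose lists) ∘ code

  c∈ : ∀ u → c u ∈ palette u
  c∈ u = subst (λ v → c u ∈ palette v) (node-code u) (proj₂ (proj₂ (choose lists)) (code u))

  proper : ∀ {u v} → u ⟶ v → c u ≢ (sign u v ◃ 1) ℤ.* c v
  proper {u} {v} u⟶v = subst₂ (λ u′ v′ → c u ≢ (sign u′ v′ ◃ 1) ℤ.* c v) (node-code u) (node-code v)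
    (proj₁ (proj₂ (choose lists)) (⟶⇒edge u⟶v))

theorem4p2 : Σ[ G ∈ Graph ] Σ[ σ ∈ Signature G ] (Planar G × HasGirth G 4 × ¬ SignedChoosable G σ 3 × Choosable G 3)
theorem4p2 = G , σ , planar , girth , not-signed-choosable , choosable
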